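{- Let $G$ be a graph. Let $\tau:V(G)\to\mathbb{N}_0$ be a threshold function for $G$ with $\tau(u)\le d_G(u)$ and $\tau(u)\in\{0,1,d_G(u)\}$ for every vertex $u$ of $G$, and such that $G$ has no edge $uv$ with $\tau(u)=d_G(u)$ and $\tau(v)=d_G(v)$. A set $X$ of vertices of $G$ is a non-monotone target set for $(G,\tau)$ if and only if the following conditions (1) and (2) hold: (1) For every set $U$ that is the vertex set of a connected component of the induced subgraph $G\big[\{u\in V(G):\tau(u)\in\{0,1\}\}\big]$ with $|U|\ge 2$ and $\tau(u)=1$ for every $u\in U$: (a) If $G[U]$ is not bipartite, then $X\cap N_G[U]\neq\emptyset$. (b) If $G[U]$ is bipartite with partite sets $A$ and $B$, and $A'=N_G(B)\setminus N_G[A]$, $B'=N_G(A)\setminus N_G[B]$, and $C=N_G(A)\cap N_G(B)$, then $$X\cap(A\cup A'\cup C)\neq\emptyset\quad\text{and}\quad X\cap(B\cup B'\cup C)\neq\emptyset.$$ (2) If $u$ is a vertex with $\tau(u)=1$ such that $\tau(v)=d_G(v)$ for every $v\in N_G(u)$, then there are two (not necessarily distinct) neighbors $v_1$ and $v_2$ of $u$ such that $v_1\in X$ and $N_G(v_2)\subseteq X$.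
   Context: Graphs are finite, simple, and undirected. $\mathbb{N}=\{1,2,3,\ldots\}$ and $\mathbb{N}_0=\{0,1,2,\ldots\}$. $d_G(u)$ is the degree of $u$ in $G$ and $N_G(u)$ is the set of neighbors of $u$. For a set $Y$ of vertices of $G$, $N_G(Y)=\left(\bigcup_{u\in Y}N_G(u)\right)\setminus Y$ and $N_G[Y]=Y\cup N_G(Y)$. $G[Y]$ is the subgraph of $G$ induced by $Y$. A threshold function for $G$ is a function $\tau:V(G)\to\mathbb{N}_0$. For $X\subseteq V(G)$, the non-monotone activation process on $(G,\tau)$ starting with $X$ is the sequence $(X_t)_{t\in\mathbb{N}_0}$ with $X_0=X$ and $X_t=\{u\in V(G):|N_G(u)\cap X_{t-1}|\ge\tau(u)\}$ for every $t\in\mathbb{N}$. The set $X$ is a non-monotone target set for $(G,\tau)$ if there is some $t_0\in\mathbb{N}_0$ such that $X_t=V(G)$ for every $t\ge t_0$. -}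

module Defs where

open import Data.Fin using (Fin)
open import Data.Fin.Subset
  using (Subset; _∈_; _⊆_; _∩_; _∪_; _─_; ⋃; ⊤; ∣_∣; Nonempty; Empty)
open import Data.Fin.Subset.Properties using (_∈?_)
open import Data.List using (filter; map; allFin)
open import Data.Nat using (ℕ; zero; suc; _≤_; _≤?_; _≥_; _≟_)
open import Data.Product using (_×_; ∃; ∃₂)
open import Data.Sum using (_⊎_)
open import Data.Vec using (tabulate)
open import Level using (0ℓ)
open import Relation.Binary using (Rel; Symmetric; Irreflexive; Decidable)
open import Relation.Binary.Construct.Closure.ReflexiveTransitive using (Star)
open import Relation.Binary.PropositionalEquality using (_≡_)
open import Relation.Nullary using (does)
open import Relation.Nullary.Decidable using (_⊎-dec_)
open import Relation.Unary using (Pred) renaming (Decidable to Decidable₁)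

⟪_⟫ : ∀ {n} {P : Pred (Fin n) 0ℓ} → Decidable₁ P → Subset n
⟪ P? ⟫ = tabulate (λ u → does (P? u))

record Graph (n : ℕ) : Set₁ where
  infix 4 _~_ _~?_
  field
    _~_      : Rel (Fin n) 0ℓ
    _~?_     : Decidable _~_
    ~-sym    : Symmetric _~_
    ~-irrefl : Irreflexive _≡_ _~_

  nbrs : Fin n → Subset n
  nbrs u = ⟪ u ~?_ ⟫

  deg : Fin n → ℕ
  deg u = ∣ nbrs u ∣

  -- The open neighbourhood of a set excludes the set itself.
  N⟨_⟩ : Subset n → Subset n
  N⟨ Y ⟩ = ⋃ (map nbrs (filter (_∈? Y) (allFin n))) ─ Y

  N[_] : Subset n → Subset n
  N[ Y ] = Y ∪ N⟨ Y ⟩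

  -- Adjacency in the induced subgraph G[Y], whose vertex set is Y.
  Induced : Subset n → Rel (Fin n) 0ℓ
  Induced Y u v = u ∈ Y × v ∈ Y × u ~ v

  -- G[Y] is connected; the graph without vertices does not count as connected.
  Connected : Subset n → Set
  Connected Y = Nonempty Y × (∀ u v → u ∈ Y → v ∈ Y → Star (Induced Y) u v)

  -- U is the vertex set of a connected component of G[W]:
  -- a maximal subset of W inducing a connected subgraph.
  record IsComponent (W U : Subset n) : Set where
    field
      within    : U ⊆ W
      connected : Connected U
      maximal   : ∀ U′ → U′ ⊆ W → Connected U′ → U ⊆ U′ → U′ ⊆ U

  -- G[U] is bipartite with partite sets A and B.
  record IsBipartition (U A B : Subset n) : Set where
    field
      cover    : A ∪ B ≡ U
      disjoint : Empty (A ∩ B)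
      crossing : ∀ u v → Induced U u v → (u ∈ A × v ∈ B) ⊎ (u ∈ B × v ∈ A)

  Bipartite : Subset n → Set
  Bipartite U = ∃₂ λ A B → IsBipartition U A B

  activation : (τ : Fin n → ℕ) → Subset n → ℕ → Subset n
  activation τ X zero    = X
  activation τ X (suc t) = ⟪ (λ u → τ u ≤? ∣ nbrs u ∩ activation τ X t ∣) ⟫

  IsNonMonotoneTargetSet : (τ : Fin n → ℕ) → Subset n → Set
  IsNonMonotoneTargetSet τ X = ∃ λ t₀ → ∀ t → t ≥ t₀ → activation τ X t ≡ ⊤

  threshold01 : (τ : Fin n → ℕ) → Subset n
  threshold01 τ = ⟪ (λ u → (τ u ≟ 0) ⊎-dec (τ u ≟ 1)) ⟫

{-# OPTIONS --safe #-}

-- A vertex with threshold deg forces all its neighbours, which have threshold at most 1, to be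
-- active one step later, and so is itself active again after two steps; likewise for an edge
-- between two vertices of threshold at most 1.  Activity therefore recurs with period 2 and
-- spreads along walks, with time and walk length advancing together: a component with all
-- thresholds 1 is filled in both parities of time by any initial seed if it contains an odd
-- closed walk, and by one seed for each parity if it is bipartite.  A vertex of threshold 1
-- whose neighbours all have threshold deg likewise needs one seed for each parity: an active
-- neighbour for odd times, a neighbour that becomes active at time 1 for even times.
-- Conversely, tracing activity backwards in time from a full configuration keeps it inside the
-- closed neighbourhood of the component, alternating between its two sides in the bipartite
-- case, down to time 0.
module Submission where

open import Defs
open import Data.Nat using (ℕ; _≤_)
open import Data.Fin using (Fin)
open import Data.Fin.Subset using (Subset; _∈_; _⊆_; _∩_; _∪_; _─_; ∣_∣; Nonempty)
open import Data.Product using (_×_; ∃₂)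
open import Data.Sum using (_⊎_)
open import Function.Bundles using (_⇔_)
open import Relation.Binary.PropositionalEquality using (_≡_)
open import Relation.Nullary using (¬_)

open import Data.Empty using (⊥-elim)
open import Data.Fin.Properties using (any?)
open import Data.Fin.Subset using (_∉_; _⊃_; ⊤; ⋃; ⁅_⁆; inside; outside)
open import Data.Fin.Subset.Induction using (Acc; acc; ⊃-wellFounded)
open import Data.Fin.Subset.Properties
open import Data.List using (List; []; _∷_; map; filter; allFin; tabulate)
open import Data.List.Extrema.Nat using (max; xs≤max)
open import Data.List.Membership.Propositional using () renaming (_∈_ to _∈ˡ_)
open import Data.List.Membership.Propositional.Properties
  using (∈-map∘filter⁺; ∈-map∘filter⁻; ∈-allFin)
open import Data.List.Relation.Unary.All.Properties using (tabulate⁻)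
open import Data.List.Relation.Unary.Any using (here; there)
open import Data.Nat using (zero; suc; _+_; _*_; _<_; _≥_; _⊔_; _≟_; _≤?_; z≤n; s≤s)
open import Data.Nat.DivMod using (_/_; _%_; m≡m%n+[m/n]*n; m%n<n; m*n/n≡m; /-monoˡ-≤)
open import Data.Nat.Properties
  using (≤-trans; ≤-reflexive; <-irrefl; +-comm; +-suc; m≤m*n; m≤m+n;
         m⊔n≤o⇒m≤o; m⊔n≤o⇒n≤o; n≤1+n)
open import Data.Product using (∃; _,_; proj₁; proj₂; map₂)
open import Data.Sum using (inj₁; inj₂; [_,_]′; fromInj₂)
open import Data.Vec using () renaming (_∷_ to _∷ᵥ_; here to hereᵥ; there to thereᵥ)
open import Data.Vec.Properties using (lookup∘tabulate; lookup⇒[]=; []=⇒lookup)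
open import Function using (_∘_; mk⇔)
open import Function.Bundles using (Equivalence)
open import Level using (0ℓ)
open import Relation.Binary using (Rel; Decidable)
open import Relation.Binary.Construct.Closure.ReflexiveTransitive
  using (Star; ε; _◅_; _◅◅_; return; reverse) renaming (map to map*)
open import Relation.Binary.PropositionalEquality using (_≢_; refl; sym; trans; cong; subst)
open import Relation.Nullary using (yes; no; does; contradiction)
open import Relation.Nullary.Decidable using (dec-true; _×-dec_; _⊎-dec_; ¬?; decidable-stable)
open import Relation.Unary using (Pred) renaming (Decidable to Decidable₁)

-- Membership and cardinality of finite subsets.

module _ {n} {P : Pred (Fin n) 0ℓ} (P? : Decidable₁ P) where

  ∈⟪⟫⁺ : ∀ {u} → P u → u ∈ ⟪ P? ⟫
  ∈⟪⟫⁺ {u} p = lookup⇒[]= u _ (trans (lookup∘tabulate _ u) (dec-true (P? u) p))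

  ∈⟪⟫⁻ : ∀ {u} → u ∈ ⟪ P? ⟫ → P u
  ∈⟪⟫⁻ {u} u∈ with P? u | trans (sym (lookup∘tabulate (does ∘ P?) u)) ([]=⇒lookup u∈)
  ... | yes p | _ = p
  ... | no _  | ()

x∈p─q⇒x∉q : ∀ {n} {x : Fin n} (p q : Subset n) → x ∈ p ─ q → x ∉ q
x∈p─q⇒x∉q (inside  ∷ᵥ p) (outside ∷ᵥ q) hereᵥ ()
x∈p─q⇒x∉q (_ ∷ᵥ p) (_ ∷ᵥ q) (thereᵥ x∈p─q) (thereᵥ x∈q) = x∈p─q⇒x∉q p q x∈p─q x∈q

x∈⋃⁺ : ∀ {n} {x : Fin n} {p} {ps : List (Subset n)} → p ∈ˡ ps → x ∈ p → x ∈ ⋃ ps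
x∈⋃⁺ (here refl) x∈p = x∈p∪q⁺ (inj₁ x∈p)
x∈⋃⁺ (there p∈)  x∈p = x∈p∪q⁺ (inj₂ (x∈⋃⁺ p∈ x∈p))

x∈⋃⁻ : ∀ {n} {x : Fin n} (ps : List (Subset n)) → x ∈ ⋃ ps → ∃ λ p → p ∈ˡ ps × x ∈ p
x∈⋃⁻ []       x∈ = contradiction x∈ ∉⊥
x∈⋃⁻ (p ∷ ps) x∈ with x∈p∪q⁻ p (⋃ ps) x∈
... | inj₁ x∈p = p , here refl , x∈p
... | inj₂ x∈ps = map₂ (λ (q∈ , x∈q) → there q∈ , x∈q) (x∈⋃⁻ ps x∈ps)

Nonempty⇒0<∣p∣ : ∀ {n} {p : Subset n} → Nonempty p → 0 < ∣ p ∣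
Nonempty⇒0<∣p∣ (x , x∈p) = ≤-trans (s≤s z≤n) (x∈p⇒∣p-x∣<∣p∣ x∈p)

0<∣p∣⇒Nonempty : ∀ {n} (p : Subset n) → 0 < ∣ p ∣ → Nonempty p
0<∣p∣⇒Nonempty {n} p 0<∣p∣ = decidable-stable (nonempty? p) λ empty →
  <-irrefl (sym (trans (cong ∣_∣ (Empty-unique empty)) (∣⊥∣≡0 n))) 0<∣p∣

x≢y⇒2≤∣p∣ : ∀ {n} {x y : Fin n} {p : Subset n} → x ∈ p → y ∈ p → x ≢ y → 2 ≤ ∣ p ∣
x≢y⇒2≤∣p∣ x∈p y∈p x≢y =
  ≤-trans (s≤s (Nonempty⇒0<∣p∣ (_ , x∈p∧x≢y⇒x∈p-y x∈p x≢y))) (x∈p⇒∣p-x∣<∣p∣ y∈p)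

-- An element of `p` outside `q` would make `p ∩ q` a proper, hence strictly smaller, subset of `p`.
∣p∣≤∣p∩q∣⇒p⊆q : ∀ {n} (p q : Subset n) → ∣ p ∣ ≤ ∣ p ∩ q ∣ → p ⊆ q
∣p∣≤∣p∩q∣⇒p⊆q p q ∣p∣≤ {x} x∈p = decidable-stable (x ∈? q) λ x∉q →
  <-irrefl refl (≤-trans
    (p⊂q⇒∣p∣<∣q∣ (p∩q⊆p p q , x , x∈p , x∉q ∘ proj₂ ∘ x∈p∩q⁻ p q)) ∣p∣≤)

-- Reachability sets of a decidable relation.

module _ {n} {R : Rel (Fin n) 0ℓ} (R? : Decidable R) (u : Fin n) where

  private
    -- Adds an endpoint of a step leaving `S` until no step leaves it; this ends because strictly
    -- growing chains of subsets of `Fin n` are finite.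
    saturate : ∀ S → Acc _⊃_ S → u ∈ S → (∀ {v} → v ∈ S → Star R u v) →
      ∃ λ S′ → ∀ {v} → v ∈ S′ ⇔ Star R u v
    saturate S (acc rec) u∈S sound
      with any? (λ v → any? (λ w → (v ∈? S) ×-dec R? v w ×-dec ¬? (w ∈? S)))
    ... | no closed = S , mk⇔ sound (complete u∈S)
      where
      complete : ∀ {v w} → v ∈ S → Star R v w → w ∈ S
      complete v∈S ε = v∈S
      complete v∈S (r ◅ rs) = complete
        (decidable-stable (_ ∈? S) λ w∉S → closed (_ , _ , v∈S , r , w∉S)) rs
    ... | yes (v , w , v∈S , r , w∉S) =
      saturate (S ∪ ⁅ w ⁆)
        (rec (p⊆p∪q _ , w , x∈p∪q⁺ (inj₂ (x∈⁅x⁆ w)) , w∉S))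
        (x∈p∪q⁺ (inj₁ u∈S))
        ([ sound , (λ x∈ → subst (Star R u) (sym (x∈⁅y⁆⇒x≡y w x∈)) (sound v∈S ◅◅ return r)) ]′
          ∘ x∈p∪q⁻ S _)

  reachable : ∃ λ S → ∀ {v} → v ∈ S ⇔ Star R u v
  reachable = saturate ⁅ u ⁆ (⊃-wellFounded _) (x∈⁅x⁆ u)
    λ v∈ → subst (Star R u) (sym (x∈⁅y⁆⇒x≡y u v∈)) ε

-- Carries a property from a late time, where everything is active, back to an initial time of the
-- same parity.
rewind : ∀ {P : ℕ → Set} → (∀ t → P (2 + t) → P t) → ∀ s j → P (j * 2 + s) → P s
rewind step s zero    p = p
rewind step s (suc j) p = rewind step s j (step (j * 2 + s) p)

-- Neighbourhoods, components and bipartitions.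

module _ {n} (G : Graph n) where
  open Graph G

  ∈nbrs⁺ : ∀ {u v} → u ~ v → v ∈ nbrs u
  ∈nbrs⁺ {u} = ∈⟪⟫⁺ (u ~?_)

  ∈nbrs⁻ : ∀ {u v} → v ∈ nbrs u → u ~ v
  ∈nbrs⁻ {u} = ∈⟪⟫⁻ (u ~?_)

  ∈N⟨⟩⁺ : ∀ {Y x y} → y ∈ Y → y ~ x → x ∉ Y → x ∈ N⟨ Y ⟩
  ∈N⟨⟩⁺ {Y} y∈Y y~x = x∈p∧x∉q⇒x∈p─q
    (x∈⋃⁺ (∈-map∘filter⁺ nbrs (_∈? Y) (_ , ∈-allFin _ , refl , y∈Y)) (∈nbrs⁺ y~x))

  ∈N⟨⟩⁻ : ∀ {Y x} → x ∈ N⟨ Y ⟩ → x ∉ Y × ∃ λ y → y ∈ Y × y ~ x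
  ∈N⟨⟩⁻ {Y} {x} x∈ with x∈⋃⁻ (map nbrs (filter (_∈? Y) (allFin n))) (p─q⊆p _ Y x∈)
  ... | p , p∈ , x∈p with ∈-map∘filter⁻ nbrs (_∈? Y) {xs = allFin n} p∈
  ... | y , _ , refl , y∈Y = x∈p─q⇒x∉q _ Y x∈ , y , y∈Y , ∈nbrs⁻ x∈p

  Induced? : ∀ Y → Decidable (Induced Y)
  Induced? Y u v = (u ∈? Y) ×-dec (v ∈? Y) ×-dec (u ~? v)

  Induced-sym : ∀ {Y u v} → Induced Y u v → Induced Y v u
  Induced-sym (u∈ , v∈ , u~v) = v∈ , u∈ , ~-sym u~v

  -- Adjoining `w` to `U` keeps the induced subgraph connected through `u`, so maximality absorbs
  -- `w`.
  component-closed : ∀ {W U} → IsComponent W U → ∀ {u w} → u ∈ U → u ~ w → w ∈ W → w ∈ U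
  component-closed {W} {U} comp {u} {w} u∈U u~w w∈W =
    maximal U′ U′⊆W (proj₁ connected′ , proj₂ connected′) (p⊆p∪q _) w∈U′
    where
    open IsComponent comp
    U′ = U ∪ ⁅ w ⁆
    U⊆U′ : U ⊆ U′
    U⊆U′ = p⊆p∪q _
    w∈U′ : w ∈ U′
    w∈U′ = x∈p∪q⁺ (inj₂ (x∈⁅x⁆ w))
    U′⊆W : U′ ⊆ W
    U′⊆W = [ within , (λ x∈ → subst (_∈ W) (sym (x∈⁅y⁆⇒x≡y w x∈)) w∈W) ]′ ∘ x∈p∪q⁻ U _
    from-u : ∀ {x} → x ∈ U′ → Star (Induced U′) u x
    from-u x∈U′ with x∈p∪q⁻ U _ x∈U′
    ... | inj₁ x∈U = map* (λ (a∈ , b∈ , a~b) → U⊆U′ a∈ , U⊆U′ b∈ , a~b)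
                          (proj₂ connected _ _ u∈U x∈U)
    ... | inj₂ x∈ with refl ← x∈⁅y⁆⇒x≡y w x∈ = return (U⊆U′ u∈U , w∈U′ , u~w)
    connected′ : Connected U′
    connected′ = (w , w∈U′) , λ x y x∈ y∈ → reverse Induced-sym (from-u x∈) ◅◅ from-u y∈

  component : ∀ W {w} → w ∈ W → ∃ λ U → w ∈ U × IsComponent W U
  component W {w} w∈W = U , from ε , record
    { within    = λ x∈U → end∈W w∈W (to x∈U)
    ; connected = (w , from ε) ,
        λ x y x∈ y∈ → reverse Induced-sym (lift (from ε) (to x∈)) ◅◅ lift (from ε) (to y∈)
    ; maximal   = λ U′ U′⊆W (_ , connected′) U⊆U′ x∈U′ →
        from (map* (λ (a∈ , b∈ , a~b) → U′⊆W a∈ , U′⊆W b∈ , a~b)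
                   (connected′ w _ (U⊆U′ (from ε)) x∈U′))
    }
    where
    U = proj₁ (reachable (Induced? W) w)
    to : ∀ {x} → x ∈ U → Star (Induced W) w x
    to = Equivalence.to (proj₂ (reachable (Induced? W) w))
    from : ∀ {x} → Star (Induced W) w x → x ∈ U
    from = Equivalence.from (proj₂ (reachable (Induced? W) w))
    end∈W : ∀ {x y} → x ∈ W → Star (Induced W) x y → y ∈ W
    end∈W x∈W ε = x∈W
    end∈W _ ((_ , y∈W , _) ◅ rs) = end∈W y∈W rs
    -- Each vertex on a walk that starts in `U` is itself reachable from `w`, so the walk never
    -- leaves `U`.
    lift : ∀ {x y} → x ∈ U → Star (Induced W) x y → Star (Induced U) x y
    lift x∈U ε = ε
    lift x∈U (r@(_ , _ , x~y) ◅ rs) = (x∈U , y∈U , x~y) ◅ lift y∈U rs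
      where y∈U = from (to x∈U ◅◅ return r)

  bipartition-swap : ∀ {U A B} → IsBipartition U A B → IsBipartition U B A
  bipartition-swap {U} {A} {B} bip = record
    { cover    = trans (∪-comm B A) cover
    ; disjoint = disjoint ∘ subst Nonempty (∩-comm B A)
    ; crossing = λ u v → [ inj₂ , inj₁ ]′ ∘ crossing u v
    }
    where open IsBipartition bip

  bipartition-cross : ∀ {U A B} → IsBipartition U A B → ∀ {x y} → Induced U x y → x ∈ A → y ∈ B
  bipartition-cross bip xy x∈A with IsBipartition.crossing bip _ _ xy
  ... | inj₁ (_ , y∈B) = y∈B
  ... | inj₂ (x∈B , _) = contradiction (_ , x∈p∩q⁺ (x∈A , x∈B)) (IsBipartition.disjoint bip)

  -- x ∈ A ∪ A′ ∪ C, in the notation of the theorem.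
  OnSide : (A B : Subset n) → Fin n → Set
  OnSide A B x = x ∈ A ⊎ (x ∉ A × x ∉ B × ∃ λ b → b ∈ B × b ~ x)

  onSide⁺ : ∀ {A B x} → OnSide A B x → x ∈ A ∪ (N⟨ B ⟩ ─ N[ A ]) ∪ (N⟨ A ⟩ ∩ N⟨ B ⟩)
  onSide⁺ (inj₁ x∈A) = x∈p∪q⁺ (inj₁ x∈A)
  -- A neighbour of `B` outside both sides lies in `C` if it also has a neighbour in `A`, and in
  -- `A′` otherwise.
  onSide⁺ {A} {B} {x} (inj₂ (x∉A , x∉B , b , b∈B , b~x)) with x ∈? N[ A ]
  ... | no x∉ = x∈p∪q⁺ (inj₂ (x∈p∪q⁺ (inj₁ (x∈p∧x∉q⇒x∈p─q (∈N⟨⟩⁺ b∈B b~x x∉B) x∉))))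
  ... | yes x∈ = x∈p∪q⁺ (inj₂ (x∈p∪q⁺ (inj₂ (x∈p∩q⁺
    (fromInj₂ (⊥-elim ∘ x∉A) (x∈p∪q⁻ A _ x∈) , ∈N⟨⟩⁺ b∈B b~x x∉B)))))

  onSide⁻ : ∀ {A B x} → x ∈ A ∪ (N⟨ B ⟩ ─ N[ A ]) ∪ (N⟨ A ⟩ ∩ N⟨ B ⟩) → OnSide A B x
  onSide⁻ {A} {B} x∈ with x∈p∪q⁻ A _ x∈
  ... | inj₁ x∈A = inj₁ x∈A
  ... | inj₂ x∈′ with x∈p∪q⁻ (N⟨ B ⟩ ─ N[ A ]) _ x∈′
  ...   | inj₁ x∈A′ = inj₂ (x∈p─q⇒x∉q _ N[ A ] x∈A′ ∘ x∈p∪q⁺ ∘ inj₁ , ∈N⟨⟩⁻ (p─q⊆p _ N[ A ] x∈A′))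
  ...   | inj₂ x∈C with x∈p∩q⁻ N⟨ A ⟩ _ x∈C
  ...     | x∈NA , x∈NB = inj₂ (proj₁ (∈N⟨⟩⁻ x∈NA) , ∈N⟨⟩⁻ x∈NB)

  -- Single steps of the activation process.

  module _ (τ : Fin n → ℕ)
           (τ≤deg : ∀ u → τ u ≤ deg u)
           (τ∈01deg : ∀ u → τ u ≡ 0 ⊎ τ u ≡ 1 ⊎ τ u ≡ deg u)
           (indep : ∀ u v → u ~ v → ¬ (τ u ≡ deg u × τ v ≡ deg v))
           (X : Subset n) where

    private
      W : Subset n
      W = threshold01 τ

      X⟨_⟩ : ℕ → Subset n
      X⟨ t ⟩ = activation τ X t

    ∈W⁻ : ∀ {u} → u ∈ W → τ u ≡ 0 ⊎ τ u ≡ 1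
    ∈W⁻ = ∈⟪⟫⁻ (λ u → (τ u ≟ 0) ⊎-dec (τ u ≟ 1))

    ∈W⁺ : ∀ {u} → τ u ≡ 0 ⊎ τ u ≡ 1 → u ∈ W
    ∈W⁺ = ∈⟪⟫⁺ (λ u → (τ u ≟ 0) ⊎-dec (τ u ≟ 1))

    ∈W⇒τ≤1 : ∀ {u} → u ∈ W → τ u ≤ 1
    ∈W⇒τ≤1 u∈W with ∈W⁻ u∈W
    ... | inj₁ τ≡0 rewrite τ≡0 = z≤n
    ... | inj₂ τ≡1 rewrite τ≡1 = s≤s z≤n

    ∉W⇒τ≡deg : ∀ {u} → u ∉ W → τ u ≡ deg u
    ∉W⇒τ≡deg {u} u∉W with τ∈01deg u
    ... | inj₁ τ≡0          = contradiction (∈W⁺ (inj₁ τ≡0)) u∉W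
    ... | inj₂ (inj₁ τ≡1)   = contradiction (∈W⁺ (inj₂ τ≡1)) u∉W
    ... | inj₂ (inj₂ τ≡deg) = τ≡deg

    nbr-of-full∈W : ∀ {u v} → τ u ≡ deg u → u ~ v → v ∈ W
    nbr-of-full∈W {u} {v} τu≡deg u~v =
      decidable-stable (v ∈? W) λ v∉W → indep u v u~v (τu≡deg , ∉W⇒τ≡deg v∉W)

    active⁺ : ∀ {u t} → τ u ≤ ∣ nbrs u ∩ X⟨ t ⟩ ∣ → u ∈ X⟨ suc t ⟩
    active⁺ {t = t} = ∈⟪⟫⁺ (λ u → τ u ≤? ∣ nbrs u ∩ X⟨ t ⟩ ∣)

    active⁻ : ∀ {u t} → u ∈ X⟨ suc t ⟩ → τ u ≤ ∣ nbrs u ∩ X⟨ t ⟩ ∣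
    active⁻ {t = t} = ∈⟪⟫⁻ (λ u → τ u ≤? ∣ nbrs u ∩ X⟨ t ⟩ ∣)

    active-τ≡0 : ∀ {u} t → τ u ≡ 0 → u ∈ X⟨ suc t ⟩
    active-τ≡0 t τ≡0 = active⁺ {t = t} (≤-trans (≤-reflexive τ≡0) z≤n)

    active-τ≤1 : ∀ {u v} t → v ∈ W → u ~ v → u ∈ X⟨ t ⟩ → v ∈ X⟨ suc t ⟩
    active-τ≤1 t v∈W u~v u∈X = active⁺ {t = t}
      (≤-trans (∈W⇒τ≤1 v∈W) (Nonempty⇒0<∣p∣ (_ , x∈p∩q⁺ (∈nbrs⁺ (~-sym u~v) , u∈X))))

    active-nbrs : ∀ {u} t → nbrs u ⊆ X⟨ t ⟩ → u ∈ X⟨ suc t ⟩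
    active-nbrs t nbrs⊆X = active⁺ {t = t}
      (≤-trans (τ≤deg _) (p⊆q⇒∣p∣≤∣q∣ λ v∈ → x∈p∩q⁺ (v∈ , nbrs⊆X v∈)))

    active-τ≡1⁻ : ∀ {u t} → τ u ≡ 1 → u ∈ X⟨ suc t ⟩ → ∃ λ v → u ~ v × v ∈ X⟨ t ⟩
    active-τ≡1⁻ {u} {t} τ≡1 u∈X
      with 0<∣p∣⇒Nonempty _ (≤-trans (≤-reflexive (sym τ≡1)) (active⁻ {t = t} u∈X))
    ... | v , v∈ with x∈p∩q⁻ (nbrs u) _ v∈
    ... | v∈nbrs , v∈X = v , ∈nbrs⁻ v∈nbrs , v∈X

    active-full⁻ : ∀ {u t} → τ u ≡ deg u → u ∈ X⟨ suc t ⟩ → nbrs u ⊆ X⟨ t ⟩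
    active-full⁻ {u} {t} τ≡deg u∈X = ∣p∣≤∣p∩q∣⇒p⊆q (nbrs u) X⟨ t ⟩
      (≤-trans (≤-reflexive (sym τ≡deg)) (active⁻ {t = t} u∈X))

    -- By `component-closed` such a neighbour lies outside `W`, which leaves only the threshold
    -- `deg`.
    outside-full : ∀ {U} → IsComponent W U → ∀ {u x} → u ∈ U → u ~ x → x ∉ U → τ x ≡ deg x
    outside-full comp u∈U u~x x∉U = ∉W⇒τ≡deg (x∉U ∘ component-closed comp u∈U u~x)

    record ComponentOfOnes (U : Subset n) : Set where
      field
        isComponent : IsComponent W U
        ones        : ∀ u → u ∈ U → τ u ≡ 1
      open IsComponent isComponent public

    Condition₁ᵃ Condition₁ᵇ : Subset n → Set
    Condition₁ᵃ U = ¬ Bipartite U → Nonempty (X ∩ N[ U ])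
    Condition₁ᵇ U = ∀ A B → IsBipartition U A B →
      let A′ = N⟨ B ⟩ ─ N[ A ]
          B′ = N⟨ A ⟩ ─ N[ B ]
          C  = N⟨ A ⟩ ∩ N⟨ B ⟩
      in Nonempty (X ∩ (A ∪ A′ ∪ C)) × Nonempty (X ∩ (B ∪ B′ ∪ C))

    Condition₂ : Set
    Condition₂ = ∀ u → τ u ≡ 1 → (∀ v → v ∈ nbrs u → τ v ≡ deg v) →
      ∃₂ λ v₁ v₂ → v₁ ∈ nbrs u × v₂ ∈ nbrs u × v₁ ∈ X × nbrs v₂ ⊆ X

    -- Necessity

    module _ {t₀} (full : ∀ t → t ≥ t₀ → X⟨ t ⟩ ≡ ⊤) where

      -- The time is written as `t₀ * 2 + s`, which is at least `t₀`, to fit `rewind`.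
      eventually-active : ∀ s v → v ∈ X⟨ t₀ * 2 + s ⟩
      eventually-active s v =
        subst (v ∈_) (sym (full _ (≤-trans (m≤m*n t₀ 2) (m≤m+n _ s)))) ∈⊤

      condition₂-necessary : Condition₂
      condition₂-necessary u τ≡1 full-nbrs =
        -- Rewinding to time 1 yields a neighbour active at time 0; rewinding to time 2 yields one
        -- active at time 1, whose neighbours must then all lie in `X`.
        let v₁ , u~v₁ , v₁∈X  = active-τ≡1⁻ {t = 0} τ≡1 (rewind step 1 t₀ (eventually-active 1 u))
            v₂ , u~v₂ , v₂∈X₁ = active-τ≡1⁻ {t = 1} τ≡1 (rewind step 2 t₀ (eventually-active 2 u))
        in v₁ , v₂ , ∈nbrs⁺ u~v₁ , ∈nbrs⁺ u~v₂ , v₁∈X ,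
           active-full⁻ {t = 0} (full-nbrs v₂ (∈nbrs⁺ u~v₂)) v₂∈X₁
        where
        -- The neighbour `v` that activates `u` has threshold `deg`, so it was active only because
        -- all its neighbours, `u` among them, were active before.
        step : ∀ t → u ∈ X⟨ 2 + t ⟩ → u ∈ X⟨ t ⟩
        step t u∈X =
          let v , u~v , v∈X = active-τ≡1⁻ {t = suc t} τ≡1 u∈X
          in active-full⁻ {t = t} (full-nbrs v (∈nbrs⁺ u~v)) v∈X (∈nbrs⁺ (~-sym u~v))

      module _ {U} (onesU : ComponentOfOnes U) where
        open ComponentOfOnes onesU

        condition₁ᵃ-necessary : Condition₁ᵃ U
        condition₁ᵃ-necessary _ =
          let u , u∈U = proj₁ connected
              x , x∈X , x∈N = rewind (λ t → step t ∘ step (suc t)) 0 t₀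
                                (u , eventually-active 0 u , x∈p∪q⁺ (inj₁ u∈U))
          in x , x∈p∩q⁺ (x∈X , x∈N)
          where
          step : ∀ t → ∃ (λ x → x ∈ X⟨ suc t ⟩ × x ∈ N[ U ]) → ∃ λ x → x ∈ X⟨ t ⟩ × x ∈ N[ U ]
          step t (x , x∈X , x∈N) with x∈p∪q⁻ U _ x∈N
          ... | inj₂ x∈N′ =
            let x∉U , u , u∈U , u~x = ∈N⟨⟩⁻ x∈N′
            in u , active-full⁻ {t = t} (outside-full isComponent u∈U u~x x∉U) x∈X (∈nbrs⁺ (~-sym u~x))
                 , x∈p∪q⁺ (inj₁ u∈U)
          ... | inj₁ x∈U with active-τ≡1⁻ {t = t} (ones x x∈U) x∈X
          ...   | y , x~y , y∈X with y ∈? U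
          ...     | yes y∈U = y , y∈X , x∈p∪q⁺ (inj₁ y∈U)
          ...     | no y∉U  = y , y∈X , x∈p∪q⁺ (inj₂ (∈N⟨⟩⁺ x∈U x~y y∉U))

        module _ {A B} (bip : IsBipartition U A B) where
          open IsBipartition bip

          A⊆U : A ⊆ U
          A⊆U = subst (_ ∈_) cover ∘ x∈p∪q⁺ ∘ inj₁

          B⊆U : B ⊆ U
          B⊆U = subst (_ ∈_) cover ∘ x∈p∪q⁺ ∘ inj₂

          -- A vertex outside `U` has threshold `deg`, so its neighbour in `B` was active one step
          -- earlier. A vertex of `A` has threshold 1, so some neighbour was active: in `B` if
          -- inside `U`, and otherwise on the side of `B` because it is adjacent to `A`.
          side-step : ∀ t → ∃ (λ x → x ∈ X⟨ suc t ⟩ × OnSide A B x) →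
                      ∃ λ x → x ∈ X⟨ t ⟩ × OnSide B A x
          side-step t (x , x∈X , inj₂ (x∉A , x∉B , b , b∈B , b~x)) =
            b , active-full⁻ {t = t} (outside-full isComponent (B⊆U b∈B) b~x x∉U) x∈X
                  (∈nbrs⁺ (~-sym b~x)) , inj₁ b∈B
            where
            x∉U : x ∉ U
            x∉U = [ x∉A , x∉B ]′ ∘ x∈p∪q⁻ A B ∘ subst (x ∈_) (sym cover)
          side-step t (x , x∈X , inj₁ x∈A) with active-τ≡1⁻ {t = t} (ones x (A⊆U x∈A)) x∈X
          ... | y , x~y , y∈X with y ∈? U
          ...   | no y∉U  =
            y , y∈X , inj₂ (y∉U ∘ B⊆U , y∉U ∘ A⊆U , x , x∈A , x~y)
          ...   | yes y∈U = y , y∈X , inj₁ (bipartition-cross bip (A⊆U x∈A , y∈U , x~y) x∈A)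

        side-necessary : ∀ {A B} → IsBipartition U A B → ∃ λ x → x ∈ X × OnSide A B x
        side-necessary {A} {B} bip =
          let u , u∈U = proj₁ connected
          in [ (λ u∈A → rewind step 0 t₀ (u , eventually-active 0 u , inj₁ u∈A))
             -- Starting at an odd time, one extra step back moves from the side of `B` to that of
             -- `A` at an even time.
             , (λ u∈B → rewind step 0 t₀ (side-step (bipartition-swap bip) (t₀ * 2 + 0)
                          (u , subst (λ t → u ∈ X⟨ t ⟩) (+-suc (t₀ * 2) 0) (eventually-active 1 u)
                             , inj₁ u∈B)))
             ]′ (x∈p∪q⁻ A B (subst (u ∈_) (sym cover) u∈U))
          where
          open IsBipartition bip
          step : ∀ t → ∃ (λ x → x ∈ X⟨ 2 + t ⟩ × OnSide A B x) →
                 ∃ λ x → x ∈ X⟨ t ⟩ × OnSide A B x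
          step t = side-step (bipartition-swap bip) t ∘ side-step bip (suc t)

        condition₁ᵇ-necessary : Condition₁ᵇ U
        condition₁ᵇ-necessary A B bip =
          let x , x∈X , x∈A* = side-necessary bip
              y , y∈X , y∈B* = side-necessary (bipartition-swap bip)
          in (x , x∈p∩q⁺ (x∈X , onSide⁺ x∈A*))
           -- Exchanging `A` and `B` reverses the intersection that defines `C`.
           , (y , x∈p∩q⁺ (y∈X , subst (λ C → y ∈ B ∪ (N⟨ A ⟩ ─ N[ B ]) ∪ C)
                                      (∩-comm N⟨ B ⟩ N⟨ A ⟩) (onSide⁺ y∈B*)))

    -- Sufficiency

    -- Activity at all late times of the parity of `s`. The offset is not reduced modulo 2, so that
    -- it can grow along a walk; `recurrent-drop` lowers it again.
    Recurrent : ℕ → Fin n → Set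
    Recurrent s v = ∃ λ k → ∀ j → k ≤ j → v ∈ X⟨ j * 2 + s ⟩

    Stable : Fin n → Set
    Stable v = Recurrent 0 v × Recurrent 1 v

    recurrent-spread : ∀ {s u v} → v ∈ W → u ~ v → Recurrent s u → Recurrent (suc s) v
    recurrent-spread {s} {u} {v} v∈W u~v (k , rec) = k , λ j k≤j →
      subst (λ t → v ∈ X⟨ t ⟩) (sym (+-suc (j * 2) s)) (active-τ≤1 (j * 2 + s) v∈W u~v (rec j k≤j))

    recurrent-drop : ∀ {s v} → Recurrent (2 + s) v → Recurrent s v
    recurrent-drop {s} {v} (k , rec) = suc k , λ where
      (suc j) (s≤s k≤j) → subst (λ t → v ∈ X⟨ t ⟩)
        (trans (+-suc (j * 2) (suc s)) (cong suc (+-suc (j * 2) s))) (rec j k≤j)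

    recurrent-persist : ∀ {s v} → (∀ t → v ∈ X⟨ t ⟩ → v ∈ X⟨ 2 + t ⟩) →
                        v ∈ X⟨ s ⟩ → Recurrent s v
    recurrent-persist {s} {v} step v∈X = 0 , λ j _ → go j
      where
      go : ∀ j → v ∈ X⟨ j * 2 + s ⟩
      go zero    = v∈X
      go (suc j) = step (j * 2 + s) (go j)

    -- The two ends of an edge inside `W` activate each other in turn.
    recurrent-edge : ∀ {s u v} → u ∈ W → v ∈ W → u ~ v → u ∈ X⟨ s ⟩ → Recurrent s u
    recurrent-edge u∈W v∈W u~v = recurrent-persist λ t u∈X →
      active-τ≤1 (suc t) u∈W (~-sym u~v) (active-τ≤1 t v∈W u~v u∈X)

    -- All neighbours of `u` lie in `W`, so `u` activates every one of them, and together they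
    -- reactivate `u`.
    recurrent-full : ∀ {s u} → τ u ≡ deg u → u ∈ X⟨ s ⟩ → Recurrent s u
    recurrent-full τ≡deg = recurrent-persist λ t u∈X → active-nbrs (suc t) λ v∈ →
      let u~v = ∈nbrs⁻ v∈ in active-τ≤1 t (nbr-of-full∈W τ≡deg u~v) u~v u∈X

    consecutive⇒stable : ∀ {s v} → Recurrent s v → Recurrent (suc s) v → Stable v
    consecutive⇒stable {zero}  r r′ = r , r′
    consecutive⇒stable {suc s} r r′ = consecutive⇒stable (recurrent-drop r′) r

    stable-τ≡0 : ∀ {v} → τ v ≡ 0 → Stable v
    stable-τ≡0 τ≡0 =
      -- Index 0 is skipped since at time 0 activity depends on `X`.
      (1 , λ { (suc j) _ → active-τ≡0 (suc (j * 2 + 0)) τ≡0 }) ,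
      (1 , λ { (suc j) _ → active-τ≡0 (suc (j * 2 + 1)) τ≡0 })

    stable⇒eventually : ∀ {v} → Stable v → ∃ λ k → ∀ t → k ≤ t → v ∈ X⟨ t ⟩
    stable⇒eventually {v} ((k₀ , rec₀) , (k₁ , rec₁)) = (k₀ ⊔ k₁) * 2 , λ t k≤t →
      let k≤t/2 = subst (_≤ t / 2) (m*n/n≡m (k₀ ⊔ k₁) 2) (/-monoˡ-≤ 2 k≤t)
          t≡    = trans (m≡m%n+[m/n]*n t 2) (+-comm (t % 2) _)
      in subst (λ t → v ∈ X⟨ t ⟩) (sym t≡)
           (parity (t / 2 * 2) (m%n<n t 2) (rec₀ (t / 2) (m⊔n≤o⇒m≤o k₀ k₁ k≤t/2))
                                           (rec₁ (t / 2) (m⊔n≤o⇒n≤o k₀ k₁ k≤t/2)))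
      where
      parity : ∀ m {b} → b < 2 → v ∈ X⟨ m + 0 ⟩ → v ∈ X⟨ m + 1 ⟩ → v ∈ X⟨ m + b ⟩
      parity _ {0} _ v∈X₀ _ = v∈X₀
      parity _ {1} _ _ v∈X₁ = v∈X₁
      parity _ {suc (suc _)} (s≤s (s≤s ()))

    -- An edge turns the offsets 0 and 1 into 1 and 2, which are again consecutive.
    stable-walk : ∀ {U} → U ⊆ W → ∀ {u v} → Star (Induced U) u v → Stable u → Stable v
    stable-walk U⊆W ε st = st
    stable-walk U⊆W ((_ , v∈U , u~v) ◅ rs) (r₀ , r₁) = stable-walk U⊆W rs
      (consecutive⇒stable (recurrent-spread (U⊆W v∈U) u~v r₀) (recurrent-spread (U⊆W v∈U) u~v r₁))

    recurrent-walk : ∀ {U} → U ⊆ W → ∀ {u v} → Star (Induced U) u v →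
                     ∃ (λ s → Recurrent s u) → ∃ λ s → Recurrent s v
    recurrent-walk U⊆W ε r = r
    recurrent-walk U⊆W ((_ , v∈U , u~v) ◅ rs) (s , r) =
      recurrent-walk U⊆W rs (suc s , recurrent-spread (U⊆W v∈U) u~v r)

    -- Components of ones that contain an edge.

    module _ {U} (onesU : ComponentOfOnes U)
             {u v} (u∈U : u ∈ U) (v∈U : v ∈ U) (u~v : u ~ v)
             (cond₁ᵃ : Condition₁ᵃ U) (cond₁ᵇ : Condition₁ᵇ U) where
      open ComponentOfOnes onesU

      TwoStep : Rel (Fin n) 0ℓ
      TwoStep x z = ∃ λ y → Induced U x y × Induced U y z

      TwoStep? : Decidable TwoStep
      TwoStep? x z = any? λ y → Induced? U x y ×-dec Induced? U y z

      recurrent∈U : ∀ {x} → x ∈ U → x ∈ X → Recurrent 0 x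
      recurrent∈U {x} x∈U x∈X with proj₂ connected x u x∈U u∈U
      -- The seed needs a neighbour in `U`: the vertex `v` if the seed is `u`, else the first vertex
      -- on its walk to `u`.
      ... | ε = recurrent-edge {0} (within x∈U) (within v∈U) u~v x∈X
      ... | (_ , y∈U , x~y) ◅ _ = recurrent-edge {0} (within x∈U) (within y∈U) x~y x∈X

      recurrent∉U : ∀ {x y} → y ∈ U → y ~ x → x ∉ U → x ∈ X → Recurrent 1 y
      recurrent∉U y∈U y~x x∉U x∈X = recurrent-spread (within y∈U) (~-sym y~x)
        (recurrent-full {0} (outside-full isComponent y∈U y~x x∉U) x∈X)

      -- Each edge of `U` switches both the side and the parity of time, so the seed's link between
      -- side and parity spreads to all of `U`.
      recurrent-side : ∀ {A B} → IsBipartition U A B → ∃ (λ x → x ∈ X × OnSide A B x) →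
                       ∀ {y} → y ∈ U → (y ∈ A → Recurrent 0 y) × (y ∈ B → Recurrent 1 y)
      recurrent-side {A} {B} bip (x , x∈X , side) {y} y∈U = start side
        where
        open IsBipartition bip
        apart : ∀ {z} {P : Set} → z ∈ A → z ∈ B → P
        apart z∈A z∈B = contradiction (_ , x∈p∩q⁺ (z∈A , z∈B)) disjoint
        Sided : Fin n → Set
        Sided z = (z ∈ A → Recurrent 0 z) × (z ∈ B → Recurrent 1 z)
        walk : ∀ {z z′} → Star (Induced U) z z′ → Sided z → Sided z′
        walk ε sz = sz
        walk (r@(_ , z′∈U , z~z′) ◅ rs) (rA , rB) with crossing _ _ r
        ... | inj₁ (z∈A , z′∈B) = walk rs
          ((λ z′∈A → apart z′∈A z′∈B) , λ _ → recurrent-spread (within z′∈U) z~z′ (rA z∈A))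
        ... | inj₂ (z∈B , z′∈A) = walk rs
          ( (λ _ → recurrent-drop (recurrent-spread (within z′∈U) z~z′ (rB z∈B)))
          , λ z′∈B → apart z′∈A z′∈B)
        start : OnSide A B x → Sided y
        start (inj₁ x∈A) = walk (proj₂ connected x y x∈U y∈U)
          ((λ _ → recurrent∈U x∈U x∈X) , λ x∈B → apart x∈A x∈B)
          where x∈U = subst (x ∈_) cover (x∈p∪q⁺ (inj₁ x∈A))
        start (inj₂ (x∉A , x∉B , b , b∈B , b~x)) = walk (proj₂ connected b y b∈U y∈U)
          ((λ b∈A → apart b∈A b∈B) , λ _ → recurrent∉U b∈U b~x x∉U x∈X)
          where
          b∈U = subst (b ∈_) cover (x∈p∪q⁺ (inj₂ b∈B))
          x∉U : x ∉ U
          x∉U = [ x∉A , x∉B ]′ ∘ x∈p∪q⁻ A B ∘ subst (x ∈_) (sym cover)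

      -- The seed for `A` supplies one parity at `u`, and the seed for `B`, with the roles of the
      -- sides exchanged, the other.
      stable-bipartite : ∀ {A B} → IsBipartition U A B → Stable u
      stable-bipartite {A} {B} bip =
        let (x , x∈) , (y , y∈) = cond₁ᵇ A B bip
            x∈X , x∈A* = x∈p∩q⁻ X _ x∈
            y∈X , y∈B* = x∈p∩q⁻ X _ y∈
            y∈B*′ = subst (λ C → y ∈ B ∪ (N⟨ A ⟩ ─ N[ B ]) ∪ C) (∩-comm N⟨ A ⟩ N⟨ B ⟩) y∈B*
            rA₀ , rB₁ = recurrent-side bip (x , x∈X , onSide⁻ x∈A*) u∈U
            rB₀ , rA₁ = recurrent-side (bipartition-swap bip) (y , y∈X , onSide⁻ y∈B*′) u∈U
        in [ (λ u∈A → rA₀ u∈A , rA₁ u∈A) , (λ u∈B → rB₀ u∈B , rB₁ u∈B) ]′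
             (x∈p∪q⁻ A B (subst (u ∈_) (sym (IsBipartition.cover bip)) u∈U))

      recurrent-even : ∀ {s x y} → Star TwoStep x y → Recurrent s x → Recurrent s y
      recurrent-even ε r = r
      recurrent-even ((_ , (_ , y∈U , x~y) , (_ , z∈U , y~z)) ◅ rs) r = recurrent-even rs
        (recurrent-drop (recurrent-spread (within z∈U) y~z (recurrent-spread (within y∈U) x~y r)))

      recurrent-seed : Nonempty (X ∩ N[ U ]) → ∃ λ s → Recurrent s u
      recurrent-seed (x , x∈) with x∈p∩q⁻ X _ x∈
      ... | x∈X , x∈N with x∈p∪q⁻ U _ x∈N
      ...   | inj₁ x∈U = recurrent-walk within (proj₂ connected x u x∈U u∈U) (0 , recurrent∈U x∈U x∈X)
      ...   | inj₂ x∈N′ with ∈N⟨⟩⁻ x∈N′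
      ...     | x∉U , y , y∈U , y~x =
        recurrent-walk within (proj₂ connected y u y∈U u∈U) (1 , recurrent∉U y∈U y~x x∉U x∈X)

      private
        -- Ends of even (S) and odd (T) walks from u.
        S T : Subset n
        S = proj₁ (reachable TwoStep? u)
        OddEnd? : Decidable₁ λ y → ∃ λ x → x ∈ S × Induced U x y
        OddEnd? y = any? λ x → (x ∈? S) ×-dec Induced? U x y
        T = ⟪ OddEnd? ⟫

        toS : ∀ {x} → Star TwoStep u x → x ∈ S
        toS = Equivalence.from (proj₂ (reachable TwoStep? u))

        fromS : ∀ {x} → x ∈ S → Star TwoStep u x
        fromS = Equivalence.to (proj₂ (reachable TwoStep? u))

        toT : ∀ {x y} → x ∈ S → Induced U x y → y ∈ T
        toT x∈S xy = ∈⟪⟫⁺ OddEnd? (_ , x∈S , xy)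

        fromT : ∀ {y} → y ∈ T → ∃ λ x → x ∈ S × Induced U x y
        fromT = ∈⟪⟫⁻ OddEnd?

        T-step : ∀ {y z} → y ∈ T → Induced U y z → z ∈ S
        T-step y∈T yz with fromT y∈T
        ... | _ , x∈S , xy = toS (fromS x∈S ◅◅ return (_ , xy , yz))

      -- Connectedness puts every vertex of `U` at the end of an even or an odd walk from `u`, and
      -- each edge exchanges the two kinds.
      no-odd-walk⇒bipartition : ¬ Nonempty (S ∩ T) → IsBipartition U S T
      no-odd-walk⇒bipartition disj = record
        { cover    = ⊆-antisym
            ([ S⊆U , (λ y∈T → proj₁ (proj₂ (proj₂ (proj₂ (fromT y∈T))))) ]′ ∘ x∈p∪q⁻ S T)
            (λ x∈U → x∈p∪q⁺ (reach (proj₂ connected u _ u∈U x∈U) (inj₁ (toS ε))))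
        ; disjoint = disj
        ; crossing = λ x y xy → cross xy
            (reach (proj₂ connected u x u∈U (proj₁ xy)) (inj₁ (toS ε)))
        }
        where
        end∈U : ∀ {x y} → x ∈ U → Star TwoStep x y → y ∈ U
        end∈U x∈U ε = x∈U
        end∈U _ ((_ , _ , (_ , z∈U , _)) ◅ rs) = end∈U z∈U rs
        S⊆U : S ⊆ U
        S⊆U = end∈U u∈U ∘ fromS
        reach : ∀ {x y} → Star (Induced U) x y → x ∈ S ⊎ x ∈ T → y ∈ S ⊎ y ∈ T
        reach ε x∈ = x∈
        reach (xy ◅ rs) (inj₁ x∈S) = reach rs (inj₂ (toT x∈S xy))
        reach (xy ◅ rs) (inj₂ x∈T) = reach rs (inj₁ (T-step x∈T xy))
        cross : ∀ {x y} → Induced U x y → x ∈ S ⊎ x ∈ T → (x ∈ S × y ∈ T) ⊎ (x ∈ T × y ∈ S)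
        cross xy (inj₁ x∈S) = inj₁ (x∈S , toT x∈S xy)
        cross xy (inj₂ x∈T) = inj₂ (x∈T , T-step x∈T xy)

      -- Even walks from `u` stay on the side of `u` and odd ones end on the other side, but `y`
      -- ends walks of both kinds.
      odd-walk⇒¬bipartite : Nonempty (S ∩ T) → ¬ Bipartite U
      odd-walk⇒¬bipartite (y , y∈) (A , B , bip) with x∈p∩q⁻ S T y∈
      ... | y∈S , y∈T with fromT y∈T
      ... | x , x∈S , xy@(_ , y∈U , _) =
        [ refute bip , refute (bipartition-swap bip) ]′
          (x∈p∪q⁻ A B (subst (u ∈_) (sym (IsBipartition.cover bip)) u∈U))
        where
        refute : ∀ {A B} → IsBipartition U A B → ¬ u ∈ A
        refute {A} {B} bip u∈A =
          contradiction (y , x∈p∩q⁺ (even (fromS y∈S) u∈A ,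
            bipartition-cross bip xy (even (fromS x∈S) u∈A))) (IsBipartition.disjoint bip)
          where
          even : ∀ {x y} → Star TwoStep x y → x ∈ A → y ∈ A
          even ε x∈A = x∈A
          even ((_ , xy , yz) ◅ rs) x∈A = even rs
            (bipartition-cross (bipartition-swap bip) yz (bipartition-cross bip xy x∈A))

      stable-component : Stable u
      -- Deciding whether `S` meets `T` decides bipartiteness. If they meet in `y`, the even walk
      -- gives recurrence at offset `s` and the odd one, through `x`, at offset `suc s`.
      stable-component with nonempty? (S ∩ T)
      ... | no disj = stable-bipartite (no-odd-walk⇒bipartition disj)
      ... | yes ne@(y , y∈) with x∈p∩q⁻ S T y∈
      ...   | y∈S , y∈T with fromT y∈T | recurrent-seed (cond₁ᵃ (odd-walk⇒¬bipartite ne))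
      ...     | x , x∈S , (_ , y∈U , x~y) | s , r =
        stable-walk within (proj₂ connected y u y∈U u∈U)
          (consecutive⇒stable (recurrent-even (fromS y∈S) r)
            (recurrent-spread (within y∈U) x~y (recurrent-even (fromS x∈S) r)))

    -- Stability on `W` and the passage to a target set.

    stable-W : (∀ U → IsComponent W U → 2 ≤ ∣ U ∣ → (∀ u → u ∈ U → τ u ≡ 1) →
                  Condition₁ᵃ U × Condition₁ᵇ U) →
               Condition₂ → ∀ {w} → w ∈ W → Stable w
    stable-W cond₁ cond₂ {w} w∈W with component W w∈W
    ... | U , w∈U , comp with any? (λ z → (z ∈? U) ×-dec (τ z ≟ 0))
    ... | yes (z , z∈U , τ≡0) =
      stable-walk within (proj₂ connected z w z∈U w∈U) (stable-τ≡0 τ≡0)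
      where open IsComponent comp
    ... | no no-zero with any? (λ v → (v ∈? W) ×-dec (w ~? v))
    ...   | yes (v , v∈W , w~v) =
      let cond₁ᵃ , cond₁ᵇ = cond₁ U comp (x≢y⇒2≤∣p∣ w∈U v∈U λ w≡v → ~-irrefl w≡v w~v) ones
      in stable-component (record { isComponent = comp ; ones = ones }) w∈U v∈U w~v cond₁ᵃ cond₁ᵇ
      where
      v∈U = component-closed comp w∈U w~v v∈W
      ones : ∀ u → u ∈ U → τ u ≡ 1
      ones u u∈U = fromInj₂ (λ τ≡0 → contradiction (u , u∈U , τ≡0) no-zero)
                            (∈W⁻ (IsComponent.within comp u∈U))
    ...   | no no-nbr =
      -- The neighbour `v₂` becomes active at time 1 and serves the even times of `w`; `v₁`, active
      -- at time 0, serves the odd ones.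
      let v₁ , v₂ , v₁∈ , v₂∈ , v₁∈X , nbrs⊆X = cond₂ w τ≡1 full-nbrs
      in recurrent-drop (recurrent-spread w∈W (~-sym (∈nbrs⁻ v₂∈))
           (recurrent-full {1} (full-nbrs v₂ v₂∈) (active-nbrs 0 nbrs⊆X)))
       , recurrent-spread w∈W (~-sym (∈nbrs⁻ v₁∈)) (recurrent-full {0} (full-nbrs v₁ v₁∈) v₁∈X)
      where
      τ≡1 : τ w ≡ 1
      τ≡1 = fromInj₂ (λ τ≡0 → contradiction (w , w∈U , τ≡0) no-zero) (∈W⁻ w∈W)
      full-nbrs : ∀ v → v ∈ nbrs w → τ v ≡ deg v
      full-nbrs v v∈ = ∉W⇒τ≡deg λ v∈W → no-nbr (v , v∈W , ∈nbrs⁻ v∈)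

    stable-W⇒target : (∀ {w} → w ∈ W → Stable w) → IsNonMonotoneTargetSet τ X
    -- From time `K` on all of `W` is active; vertices outside `W` have all their neighbours in `W`
    -- and follow one step later.
    stable-W⇒target stable = suc K ,
      λ { (suc t) (s≤s K≤t) → ⊆-antisym ⊆⊤ λ {v} _ → all-active v t K≤t }
      where
      eventually : ∀ v → ∃ λ k → ∀ t → k ≤ t → v ∈ W → v ∈ X⟨ t ⟩
      eventually v with v ∈? W
      -- The default 0 lets the maximum `K` range over all vertices.
      ... | no v∉W  = 0 , λ _ _ v∈W → contradiction v∈W v∉W
      ... | yes v∈W = map₂ (λ active t k≤t _ → active t k≤t) (stable⇒eventually (stable v∈W))
      K = max 0 (tabulate (proj₁ ∘ eventually))
      active-W : ∀ {v} t → K ≤ t → v ∈ W → v ∈ X⟨ t ⟩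
      active-W {v} t K≤t =
        proj₂ (eventually v) t (≤-trans (tabulate⁻ (xs≤max 0 (tabulate (proj₁ ∘ eventually))) v) K≤t)
      all-active : ∀ v t → K ≤ t → v ∈ X⟨ suc t ⟩
      all-active v t K≤t with v ∈? W
      ... | yes v∈W = active-W (suc t) (≤-trans K≤t (n≤1+n t)) v∈W
      ... | no v∉W  = active-nbrs t λ u∈ →
        active-W t K≤t (nbr-of-full∈W (∉W⇒τ≡deg v∉W) (∈nbrs⁻ u∈))

theorem2 : ∀ {n} (G : Graph n) (τ : Fin n → ℕ) →
    let open Graph G in
    (∀ u → τ u ≤ deg u) →
    (∀ u → τ u ≡ 0 ⊎ τ u ≡ 1 ⊎ τ u ≡ deg u) →
    (∀ u v → u ~ v → ¬ (τ u ≡ deg u × τ v ≡ deg v)) →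
    ∀ (X : Subset n) →
    IsNonMonotoneTargetSet τ X ⇔
      ( (∀ U → IsComponent (threshold01 τ) U → 2 ≤ ∣ U ∣ → (∀ u → u ∈ U → τ u ≡ 1) →
           (¬ Bipartite U → Nonempty (X ∩ N[ U ])) ×
           (∀ A B → IsBipartition U A B →
              let A′ = N⟨ B ⟩ ─ N[ A ]
                  B′ = N⟨ A ⟩ ─ N[ B ]
                  C  = N⟨ A ⟩ ∩ N⟨ B ⟩
              in Nonempty (X ∩ (A ∪ A′ ∪ C)) × Nonempty (X ∩ (B ∪ B′ ∪ C))))
      × (∀ u → τ u ≡ 1 → (∀ v → v ∈ nbrs u → τ v ≡ deg v) →
           ∃₂ λ v₁ v₂ → v₁ ∈ nbrs u × v₂ ∈ nbrs u × v₁ ∈ X × nbrs v₂ ⊆ X) )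
theorem2 G τ τ≤deg τ∈01deg indep X = mk⇔
  (λ (t₀ , full) →
    (λ U comp _ ones →
      let onesU = record { isComponent = comp ; ones = ones }
      in condition₁ᵃ-necessary G τ τ≤deg τ∈01deg indep X full onesU
       , condition₁ᵇ-necessary G τ τ≤deg τ∈01deg indep X full onesU)
    , condition₂-necessary G τ τ≤deg τ∈01deg indep X full)
  (λ (cond₁ , cond₂) →
    stable-W⇒target G τ τ≤deg τ∈01deg indep X (stable-W G τ τ≤deg τ∈01deg indep X cond₁ cond₂))
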